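{- Let $\mathbb{P}$ be a set of propositional variables and let $\phi\in\mathcal{L}(\mathbb{P})$. Then $\phi$ is a theorem of classical propositional logic if and only if $\phi$ is valid in the class of relativized Boolean algebras, i.e. for every relativized Boolean algebra $\mathbf{RB}$ and every homomorphism $h:\mathcal{L}(\mathbb{P})\to\mathbf{RB}$ there is some $X\in RB$ with $h(\phi)=1_X$.
   Context: An algebra of Boolean similarity type is $\langle A,\land,\lor,\neg,0,1\rangle$ with $0,1\in A$, $\land,\lor$ binary and $\neg$ unary operations on $A$. A homomorphism between such algebras is a function $h$ with $h(1)=1'$ that respects $\land,\lor,\neg$ (preservation of $0$ is not part of the definition). Write $1_X:=X\lor\neg X$, $0_X:=X\land\neg X$, and $Y\geq X$ iff $X\land Y=X$. A relativized Boolean algebra is an algebra of Boolean similarity type $\mathbf{RB}=\langle RB,\land,\lor,\neg,0,1\rangle$ satisfying: (RB1) $\land,\lor$ are associative, commutative, distributive (each over the other), and with $\neg$ satisfy De Morgan's laws; (RB2) $X\land X=X\lor X=X\land 1=\neg\neg X=X$; (RB3) $X\lor 1=1_X$; (RB4) $X\land 0=0$; (RB5) $X\geq Y$ implies $\neg(X\land 1_Y)=\neg X\land 1_Y$. $\mathcal{L}(\mathbb{P})$ is the propositional language with grammar $\phi::=p\mid 1\mid\neg\phi\mid(\phi\land\phi)$, $p\in\mathbb{P}$, where $1$ is the constant for truth, with abbreviations $0\equiv\neg 1$, $(\phi\lor\psi)\equiv\neg(\neg\phi\land\neg\psi)$, $(\phi\to\psi)\equiv(\neg\phi\lor\psi)$.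 It is regarded as an algebra of Boolean similarity type, with operations and constants given by their grammatical counterparts. -}

module Defs where

open import Level using (Level; _⊔_; suc)
open import Algebra.Core using (Op₁; Op₂)
import Algebra.Definitions as AlgDefs
import Algebra.Morphism.Definitions as MorphismDefs
open import Data.List.Base using (List; []; _∷_)
open import Data.List.Membership.Propositional using (_∈_)
open import Data.Product.Base using (∃-syntax)
open import Relation.Binary.Core using (Rel; _Preserves_⟶_)
open import Relation.Binary.Structures using (IsEquivalence)
open import Relation.Binary.PropositionalEquality using (_≡_; cong; cong₂; isEquivalence)

private
  variable
    p c ℓ c₁ ℓ₁ c₂ ℓ₂ : Level

-- Algebras are taken over a setoid: equality of elements is _≈_.
record BooleanTypeAlgebra (c ℓ : Level) : Set (suc (c ⊔ ℓ)) where
  infix  8 ¬_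
  infixr 7 _∧_
  infixr 6 _∨_
  infix  4 _≈_ _≥_
  field
    Carrier       : Set c
    _≈_           : Rel Carrier ℓ
    _∧_ _∨_       : Op₂ Carrier
    ¬_            : Op₁ Carrier
    0# 1#         : Carrier
    ≈-equivalence : IsEquivalence _≈_
    ∧-cong        : AlgDefs.Congruent₂ _≈_ _∧_
    ∨-cong        : AlgDefs.Congruent₂ _≈_ _∨_
    ¬-cong        : AlgDefs.Congruent₁ _≈_ ¬_

  1⟨_⟩ : Carrier → Carrier
  1⟨ X ⟩ = X ∨ ¬ X

  _≥_ : Rel Carrier ℓ
  Y ≥ X = X ∧ Y ≈ X

-- Preservation of 0# is deliberately not required.
record Homomorphism (A : BooleanTypeAlgebra c₁ ℓ₁) (B : BooleanTypeAlgebra c₂ ℓ₂)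
       : Set (c₁ ⊔ ℓ₁ ⊔ c₂ ⊔ ℓ₂) where
  private
    module A = BooleanTypeAlgebra A
    module B = BooleanTypeAlgebra B
  open MorphismDefs A.Carrier B.Carrier B._≈_
  field
    ⟦_⟧     : A.Carrier → B.Carrier
    ⟦⟧-cong : ⟦_⟧ Preserves A._≈_ ⟶ B._≈_
    1#-homo : Homomorphic₀ ⟦_⟧ A.1# B.1#
    ∧-homo  : Homomorphic₂ ⟦_⟧ A._∧_ B._∧_
    ∨-homo  : Homomorphic₂ ⟦_⟧ A._∨_ B._∨_
    ¬-homo  : Homomorphic₁ ⟦_⟧ A.¬_ B.¬_

record IsRelativizedBooleanAlgebra (A : BooleanTypeAlgebra c ℓ) : Set (c ⊔ ℓ) where
  open BooleanTypeAlgebra A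
  open AlgDefs _≈_
  field
    -- (RB1)
    ∧-assoc         : Associative _∧_
    ∨-assoc         : Associative _∨_
    ∧-comm          : Commutative _∧_
    ∨-comm          : Commutative _∨_
    ∧-distrib-∨     : _∧_ DistributesOver _∨_
    ∨-distrib-∧     : _∨_ DistributesOver _∧_
    deMorgan-∧      : ∀ X Y → ¬ (X ∧ Y) ≈ ¬ X ∨ ¬ Y
    deMorgan-∨      : ∀ X Y → ¬ (X ∨ Y) ≈ ¬ X ∧ ¬ Y
    -- (RB2)
    ∧-idem          : Idempotent _∧_
    ∨-idem          : Idempotent _∨_
    ∧-identityʳ     : RightIdentity 1# _∧_
    ¬-involutive    : Involutive ¬_
    -- (RB3)
    ∨-1#            : ∀ X → X ∨ 1# ≈ 1⟨ X ⟩
    -- (RB4)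
    ∧-zeroʳ         : RightZero 0# _∧_
    -- (RB5)
    ¬-restrict      : ∀ X Y → X ≥ Y → ¬ (X ∧ 1⟨ Y ⟩) ≈ ¬ X ∧ 1⟨ Y ⟩

record RelativizedBooleanAlgebra (c ℓ : Level) : Set (suc (c ⊔ ℓ)) where
  field
    algebra                     : BooleanTypeAlgebra c ℓ
    isRelativizedBooleanAlgebra : IsRelativizedBooleanAlgebra algebra

  open BooleanTypeAlgebra algebra public
  open IsRelativizedBooleanAlgebra isRelativizedBooleanAlgebra public

infix  8 ~_
infixr 7 _∧′_
infixr 6 _∨′_

data Formula (P : Set p) : Set p where
  var  : P → Formula P
  𝟙    : Formula P
  ~_   : Formula P → Formula P
  _∧′_ : Formula P → Formula P → Formula P

𝟘 : {P : Set p} → Formula P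
𝟘 = ~ 𝟙

_∨′_ : {P : Set p} → Formula P → Formula P → Formula P
φ ∨′ ψ = ~ (~ φ ∧′ ~ ψ)

formulaAlgebra : (P : Set p) → BooleanTypeAlgebra p p
formulaAlgebra P = record
  { Carrier       = Formula P
  ; _≈_           = _≡_
  ; _∧_           = _∧′_
  ; _∨_           = _∨′_
  ; ¬_            = ~_
  ; 0#            = 𝟘
  ; 1#            = 𝟙
  ; ≈-equivalence = isEquivalence
  ; ∧-cong        = cong₂ _∧′_
  ; ∨-cong        = cong₂ _∨′_
  ; ¬-cong        = cong ~_
  }

-- Classical provability: natural deduction for the primitive connectives.
infix 3 _⊢_

data _⊢_ {P : Set p} (Γ : List (Formula P)) : Formula P → Set p where
  hyp : ∀ {φ} → φ ∈ Γ → Γ ⊢ φ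
  𝟙-I : Γ ⊢ 𝟙
  ∧-I : ∀ {φ ψ} → Γ ⊢ φ → Γ ⊢ ψ → Γ ⊢ φ ∧′ ψ
  ∧-E₁ : ∀ {φ ψ} → Γ ⊢ φ ∧′ ψ → Γ ⊢ φ
  ∧-E₂ : ∀ {φ ψ} → Γ ⊢ φ ∧′ ψ → Γ ⊢ ψ
  ~-I : ∀ {φ} → φ ∷ Γ ⊢ 𝟘 → Γ ⊢ ~ φ
  ~-E : ∀ {φ} → Γ ⊢ ~ φ → Γ ⊢ φ → Γ ⊢ 𝟘
  raa : ∀ {φ} → ~ φ ∷ Γ ⊢ 𝟘 → Γ ⊢ φ

ClassicalTheorem : {P : Set p} → Formula P → Set p
ClassicalTheorem φ = [] ⊢ φ

Valid : (c ℓ : Level) {P : Set p} → Formula P → Set (p ⊔ suc (c ⊔ ℓ))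
Valid c ℓ {P} φ =
  (RB : RelativizedBooleanAlgebra c ℓ) →
  let open RelativizedBooleanAlgebra RB in
  (h : Homomorphism (formulaAlgebra P) algebra) →
  ∃[ X ] Homomorphism.⟦_⟧ h φ ≈ 1⟨ X ⟩

{-# OPTIONS --safe #-}

-- Soundness. Call X in a relativized Boolean algebra empty when X ≈ X ∧ ¬ X.
-- Empty elements are closed under joins and under meets with arbitrary
-- elements, so "X ∧ Y is empty" is an orthogonality relation. Given a
-- homomorphism h, interpret formulas as sets of elements that are their own
-- biorthogonals; natural deduction is sound for this interpretation, and
-- h φ ∈ ⟪ φ ⟫ ⊆ {¬ h φ}^⊥ by simultaneous induction on φ. If φ is a theorem,
-- then 1 ∈ ⟪ φ ⟫, so ¬ h φ is empty, i.e. h φ ≈ 1⟨ h φ ⟩. This bypasses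
-- Boolean-valued completeness and never decides equality of variables.
--
-- Completeness. Every Boolean algebra is a relativized Boolean algebra, in
-- particular the Lindenbaum algebra, where 1⟨ X ⟩ is the class of a theorem.

module Submission where

open import Level using (Level; _⊔_; Lift; lift; lower)
open import Algebra.Lattice.Bundles using (BooleanAlgebra)
open import Algebra.Lattice.Structures.Biased using (isBooleanAlgebraʳ)
import Algebra.Lattice.Properties.BooleanAlgebra as BooleanProperties
import Algebra.Lattice.Properties.Lattice as LatticeProperties
open import Data.List.Base using (List; []; _∷_)
open import Data.List.Relation.Binary.Subset.Propositional using (_⊆_)
open import Data.List.Relation.Binary.Subset.Propositional.Properties
  using (∷⁺ʳ; xs⊆x∷xs)
open import Data.List.Relation.Unary.All using (All; []; _∷_; lookup)
import Data.List.Relation.Unary.All as All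
open import Data.List.Relation.Unary.Any using (here)
open import Data.Product.Base using (_×_; _,_; proj₁; proj₂; swap)
open import Data.Unit.Polymorphic.Base using (⊤; tt)
open import Function.Base using (id; _∘_)
open import Function.Bundles using (_⇔_; mk⇔)
open import Relation.Binary.Bundles using (Setoid)
open import Relation.Binary.Core using (Rel)
open import Relation.Binary.Lattice.Bundles using (HeytingAlgebra)
import Relation.Binary.Lattice.Properties.HeytingAlgebra as HeytingProperties
import Relation.Binary.Lattice.Properties.DistributiveLattice as DistributiveProperties
import Relation.Binary.Lattice.Properties.Lattice as OrderLatticeProperties
open import Relation.Binary.PropositionalEquality using (refl)
import Relation.Binary.Reasoning.Setoid as SetoidReasoning
open import Relation.Unary using (Pred; _∈_; _∩_)
open import Defs

-- Empty elements and orthogonality in a relativized Boolean algebra.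

module EmptyElements {c ℓ} (RB : RelativizedBooleanAlgebra c ℓ) where

  open RelativizedBooleanAlgebra RB

  setoid : Setoid c ℓ
  setoid = record { isEquivalence = ≈-equivalence }

  open Setoid setoid public using ()
    renaming (refl to ≈-refl; sym to ≈-sym; trans to ≈-trans)
  open SetoidReasoning setoid

  ∧-congˡ : ∀ {X Y Z} → Y ≈ Z → X ∧ Y ≈ X ∧ Z
  ∧-congˡ = ∧-cong ≈-refl

  ∧-congʳ : ∀ {X Y Z} → Y ≈ Z → Y ∧ X ≈ Z ∧ X
  ∧-congʳ Y≈Z = ∧-cong Y≈Z ≈-refl

  ∧-identityˡ : ∀ X → 1# ∧ X ≈ X
  ∧-identityˡ X = ≈-trans (∧-comm 1# X) (∧-identityʳ X)

  ∧-rotate : ∀ X Y Z → X ∧ (Y ∧ Z) ≈ (X ∧ Z) ∧ Y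
  ∧-rotate X Y Z = ≈-trans (∧-congˡ (∧-comm Y Z)) (≈-sym (∧-assoc X Z Y))

  X∧1⟨X⟩≈X : ∀ X → X ∧ 1⟨ X ⟩ ≈ X
  X∧1⟨X⟩≈X X = begin
    X ∧ 1⟨ X ⟩          ≈⟨ ∧-congˡ (∨-1# X) ⟨
    X ∧ (X ∨ 1#)        ≈⟨ proj₁ ∧-distrib-∨ X X 1# ⟩
    (X ∧ X) ∨ (X ∧ 1#)  ≈⟨ ∨-cong (∧-idem X) (∧-identityʳ X) ⟩
    X ∨ X               ≈⟨ ∨-idem X ⟩
    X                   ∎

  -- By (RB3), `1⟨_⟩` is joining with `1#`, and joins distribute over meets.
  1⟨X∧Y⟩≈1⟨X⟩∧1⟨Y⟩ : ∀ X Y → 1⟨ X ∧ Y ⟩ ≈ 1⟨ X ⟩ ∧ 1⟨ Y ⟩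
  1⟨X∧Y⟩≈1⟨X⟩∧1⟨Y⟩ X Y = begin
    1⟨ X ∧ Y ⟩           ≈⟨ ∨-1# (X ∧ Y) ⟨
    (X ∧ Y) ∨ 1#         ≈⟨ proj₂ ∨-distrib-∧ 1# X Y ⟩
    (X ∨ 1#) ∧ (Y ∨ 1#)  ≈⟨ ∧-cong (∨-1# X) (∨-1# Y) ⟩
    1⟨ X ⟩ ∧ 1⟨ Y ⟩      ∎

  ¬[X∧¬X]≈1⟨X⟩ : ∀ X → ¬ (X ∧ ¬ X) ≈ 1⟨ X ⟩
  ¬[X∧¬X]≈1⟨X⟩ X = begin
    ¬ (X ∧ ¬ X)    ≈⟨ deMorgan-∧ X (¬ X) ⟩
    ¬ X ∨ ¬ (¬ X)  ≈⟨ ∨-cong ≈-refl (¬-involutive X) ⟩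
    ¬ X ∨ X        ≈⟨ ∨-comm (¬ X) X ⟩
    X ∨ ¬ X        ∎

  ¬1⟨X⟩≈X∧¬X : ∀ X → ¬ 1⟨ X ⟩ ≈ X ∧ ¬ X
  ¬1⟨X⟩≈X∧¬X X = begin
    ¬ 1⟨ X ⟩         ≈⟨ ¬-cong (¬[X∧¬X]≈1⟨X⟩ X) ⟨
    ¬ ¬ (X ∧ ¬ X)    ≈⟨ ¬-involutive (X ∧ ¬ X) ⟩
    X ∧ ¬ X          ∎

  Empty : Pred Carrier ℓ
  Empty X = X ≈ X ∧ ¬ X

  Empty-resp : ∀ {X Y} → X ≈ Y → Empty X → Empty Y
  Empty-resp X≈Y e = ≈-trans (≈-sym X≈Y) (≈-trans e (∧-cong X≈Y (¬-cong X≈Y)))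

  X∧¬X-empty : ∀ X → Empty (X ∧ ¬ X)
  X∧¬X-empty X = ≈-sym (begin
    (X ∧ ¬ X) ∧ ¬ (X ∧ ¬ X)  ≈⟨ ∧-congˡ (¬[X∧¬X]≈1⟨X⟩ X) ⟩
    (X ∧ ¬ X) ∧ 1⟨ X ⟩       ≈⟨ ∧-rotate X 1⟨ X ⟩ (¬ X) ⟨
    X ∧ (1⟨ X ⟩ ∧ ¬ X)       ≈⟨ ∧-assoc X 1⟨ X ⟩ (¬ X) ⟨
    (X ∧ 1⟨ X ⟩) ∧ ¬ X       ≈⟨ ∧-congʳ (X∧1⟨X⟩≈X X) ⟩
    X ∧ ¬ X                  ∎)

  -- De Morgan gives two joinands: emptiness of `X` makes the first `X ∧ Y`, which absorbs the
  -- second because `Y ∨ (Y ∧ ¬ Y)` is `Y ∧ 1⟨ Y ⟩`.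
  ∧-emptyˡ : ∀ {X} Y → Empty X → Empty (X ∧ Y)
  ∧-emptyˡ {X} Y e = ≈-sym (begin
    (X ∧ Y) ∧ ¬ (X ∧ Y)                  ≈⟨ ∧-congˡ (deMorgan-∧ X Y) ⟩
    (X ∧ Y) ∧ (¬ X ∨ ¬ Y)                ≈⟨ proj₁ ∧-distrib-∨ (X ∧ Y) (¬ X) (¬ Y) ⟩
    ((X ∧ Y) ∧ ¬ X) ∨ ((X ∧ Y) ∧ ¬ Y)    ≈⟨ ∨-cong (∧-rotate X (¬ X) Y) (≈-sym (∧-assoc X Y (¬ Y))) ⟨
    (X ∧ (¬ X ∧ Y)) ∨ (X ∧ (Y ∧ ¬ Y))    ≈⟨ ∨-cong (∧-assoc X (¬ X) Y) ≈-refl ⟨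
    ((X ∧ ¬ X) ∧ Y) ∨ (X ∧ (Y ∧ ¬ Y))    ≈⟨ ∨-cong (∧-congʳ e) ≈-refl ⟨
    (X ∧ Y) ∨ (X ∧ (Y ∧ ¬ Y))            ≈⟨ proj₁ ∧-distrib-∨ X Y (Y ∧ ¬ Y) ⟨
    X ∧ (Y ∨ (Y ∧ ¬ Y))                  ≈⟨ ∧-congˡ (proj₁ ∨-distrib-∧ Y Y (¬ Y)) ⟩
    X ∧ ((Y ∨ Y) ∧ 1⟨ Y ⟩)               ≈⟨ ∧-congˡ (∧-congʳ (∨-idem Y)) ⟩
    X ∧ (Y ∧ 1⟨ Y ⟩)                     ≈⟨ ∧-congˡ (X∧1⟨X⟩≈X Y) ⟩
    X ∧ Y                                ∎)

  -- (RB5) applied to 1⟨ X ⟩ ≥ X ∧ Y.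
  0-restrict : ∀ X Y → (X ∧ ¬ X) ∧ 1⟨ Y ⟩ ≈ (X ∧ ¬ X) ∨ (Y ∧ ¬ Y)
  0-restrict X Y = begin
    (X ∧ ¬ X) ∧ 1⟨ Y ⟩             ≈⟨ ∧-congʳ (∧-congʳ (X∧1⟨X⟩≈X X)) ⟨
    ((X ∧ 1⟨ X ⟩) ∧ ¬ X) ∧ 1⟨ Y ⟩  ≈⟨ ∧-congʳ (≈-trans (∧-congʳ (∧-comm X 1⟨ X ⟩)) (∧-assoc 1⟨ X ⟩ X (¬ X))) ⟩
    (1⟨ X ⟩ ∧ 0X) ∧ 1⟨ Y ⟩         ≈⟨ ∧-congʳ (∧-comm 1⟨ X ⟩ 0X) ⟩
    (0X ∧ 1⟨ X ⟩) ∧ 1⟨ Y ⟩         ≈⟨ ∧-assoc 0X 1⟨ X ⟩ 1⟨ Y ⟩ ⟩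
    0X ∧ (1⟨ X ⟩ ∧ 1⟨ Y ⟩)         ≈⟨ ∧-cong (¬1⟨X⟩≈X∧¬X X) (1⟨X∧Y⟩≈1⟨X⟩∧1⟨Y⟩ X Y) ⟨
    ¬ 1⟨ X ⟩ ∧ 1⟨ X ∧ Y ⟩          ≈⟨ ¬-restrict 1⟨ X ⟩ (X ∧ Y) 1⟨X⟩≥X∧Y ⟨
    ¬ (1⟨ X ⟩ ∧ 1⟨ X ∧ Y ⟩)        ≈⟨ ¬-cong (∧-congˡ (1⟨X∧Y⟩≈1⟨X⟩∧1⟨Y⟩ X Y)) ⟩
    ¬ (1⟨ X ⟩ ∧ (1⟨ X ⟩ ∧ 1⟨ Y ⟩)) ≈⟨ ¬-cong (∧-assoc 1⟨ X ⟩ 1⟨ X ⟩ 1⟨ Y ⟩) ⟨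
    ¬ ((1⟨ X ⟩ ∧ 1⟨ X ⟩) ∧ 1⟨ Y ⟩) ≈⟨ ¬-cong (∧-congʳ (∧-idem 1⟨ X ⟩)) ⟩
    ¬ (1⟨ X ⟩ ∧ 1⟨ Y ⟩)            ≈⟨ deMorgan-∧ 1⟨ X ⟩ 1⟨ Y ⟩ ⟩
    ¬ 1⟨ X ⟩ ∨ ¬ 1⟨ Y ⟩            ≈⟨ ∨-cong (¬1⟨X⟩≈X∧¬X X) (¬1⟨X⟩≈X∧¬X Y) ⟩
    0X ∨ (Y ∧ ¬ Y)                 ∎
    where
    0X = X ∧ ¬ X

    1⟨X⟩≥X∧Y : 1⟨ X ⟩ ≥ X ∧ Y
    1⟨X⟩≥X∧Y = ≈-trans (≈-sym (∧-rotate X 1⟨ X ⟩ Y))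
                 (≈-trans (≈-sym (∧-assoc X 1⟨ X ⟩ Y)) (∧-congʳ (X∧1⟨X⟩≈X X)))

  empty⇒¬X≈1⟨X⟩ : ∀ {X} → Empty X → ¬ X ≈ 1⟨ X ⟩
  empty⇒¬X≈1⟨X⟩ {X} e = ≈-trans (¬-cong e) (¬[X∧¬X]≈1⟨X⟩ X)

  -- For empty `Y`, `¬ Y` is `1⟨ Y ⟩`, so the left side is a local zero restricted to `1⟨ Y ⟩`.
  -- Through `0-restrict`, this is where (RB5) enters closure under joins.
  empty⇒X∧¬Y≈X∨Y : ∀ {X Y} → Empty X → Empty Y → X ∧ ¬ Y ≈ X ∨ Y
  empty⇒X∧¬Y≈X∨Y {X} {Y} eX eY = begin
    X ∧ ¬ Y                ≈⟨ ∧-cong eX (empty⇒¬X≈1⟨X⟩ eY) ⟩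
    (X ∧ ¬ X) ∧ 1⟨ Y ⟩     ≈⟨ 0-restrict X Y ⟩
    (X ∧ ¬ X) ∨ (Y ∧ ¬ Y)  ≈⟨ ∨-cong eX eY ⟨
    X ∨ Y                  ∎

  -- After expansion, emptiness reduces the two joinands to `X ∧ ¬ Y` and `Y ∧ ¬ X`, each of which
  -- is the whole join by the preceding lemma.
  ∨-empty : ∀ {X Y} → Empty X → Empty Y → Empty (X ∨ Y)
  ∨-empty {X} {Y} eX eY = ≈-sym (begin
    (X ∨ Y) ∧ ¬ (X ∨ Y)                  ≈⟨ ∧-congˡ (deMorgan-∨ X Y) ⟩
    (X ∨ Y) ∧ (¬ X ∧ ¬ Y)                ≈⟨ proj₂ ∧-distrib-∨ (¬ X ∧ ¬ Y) X Y ⟩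
    (X ∧ (¬ X ∧ ¬ Y)) ∨ (Y ∧ (¬ X ∧ ¬ Y))
      ≈⟨ ∨-cong (≈-sym (∧-assoc X (¬ X) (¬ Y)))
                (≈-trans (∧-congˡ (∧-comm (¬ X) (¬ Y))) (≈-sym (∧-assoc Y (¬ Y) (¬ X)))) ⟩
    ((X ∧ ¬ X) ∧ ¬ Y) ∨ ((Y ∧ ¬ Y) ∧ ¬ X)  ≈⟨ ∨-cong (∧-congʳ eX) (∧-congʳ eY) ⟨
    (X ∧ ¬ Y) ∨ (Y ∧ ¬ X)                ≈⟨ ∨-cong (empty⇒X∧¬Y≈X∨Y eX eY) (empty⇒X∧¬Y≈X∨Y eY eX) ⟩
    (X ∨ Y) ∨ (Y ∨ X)                    ≈⟨ ∨-cong ≈-refl (∨-comm Y X) ⟩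
    (X ∨ Y) ∨ (X ∨ Y)                    ≈⟨ ∨-idem (X ∨ Y) ⟩
    X ∨ Y                                ∎)

  ¬1-empty : Empty (¬ 1#)
  ¬1-empty = Empty-resp (∧-identityˡ (¬ 1#)) (X∧¬X-empty 1#)

  ¬X-empty⇒X≈1⟨X⟩ : ∀ {X} → Empty (¬ X) → X ≈ 1⟨ X ⟩
  ¬X-empty⇒X≈1⟨X⟩ {X} e = begin
    X              ≈⟨ ¬-involutive X ⟨
    ¬ ¬ X          ≈⟨ empty⇒¬X≈1⟨X⟩ e ⟩
    ¬ X ∨ ¬ ¬ X    ≈⟨ ∨-cong ≈-refl (¬-involutive X) ⟩
    ¬ X ∨ X        ≈⟨ ∨-comm (¬ X) X ⟩
    X ∨ ¬ X        ∎

  infix 4 _⊥_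
  infix 9 _^⊥

  _⊥_ : Rel Carrier ℓ
  X ⊥ Y = Empty (X ∧ Y)

  ⊥-sym : ∀ {X Y} → X ⊥ Y → Y ⊥ X
  ⊥-sym {X} {Y} = Empty-resp (∧-comm X Y)

  ⊥-respʳ : ∀ {X Y Z} → Y ≈ Z → X ⊥ Y → X ⊥ Z
  ⊥-respʳ Y≈Z = Empty-resp (∧-congˡ Y≈Z)

  ⊥-weaken : ∀ {X Y} Z → X ⊥ Y → X ∧ Z ⊥ Y
  ⊥-weaken {X} {Y} Z X⊥Y =
    Empty-resp (≈-trans (≈-sym (∧-rotate X Z Y)) (≈-sym (∧-assoc X Z Y))) (∧-emptyˡ Z X⊥Y)

  ⊥-∨ : ∀ {X Y Z} → X ⊥ Y → X ⊥ Z → X ⊥ Y ∨ Z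
  ⊥-∨ {X} {Y} {Z} X⊥Y X⊥Z =
    Empty-resp (≈-sym (proj₁ ∧-distrib-∨ X Y Z)) (∨-empty X⊥Y X⊥Z)

  _^⊥ : ∀ {a} → Pred Carrier a → Pred Carrier (c ⊔ ℓ ⊔ a)
  (S ^⊥) X = ∀ Y → Y ∈ S → X ⊥ Y

-- Soundness of natural deduction for the orthogonality interpretation.

module Soundness {p c ℓ} {P : Set p} (RB : RelativizedBooleanAlgebra c ℓ)
  (h : Homomorphism (formulaAlgebra P) (RelativizedBooleanAlgebra.algebra RB)) where

  open RelativizedBooleanAlgebra RB
  open EmptyElements RB
  open Homomorphism h

  -- Variables, like negations, receive a set of the form `S ^⊥`, which is automatically
  -- biorthogonally closed; intersection preserves closedness, so conjunction needs no closure
  -- operator.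
  ⟪_⟫ : Formula P → Pred Carrier (c ⊔ ℓ)
  ⟪ var p ⟫  = (_≈ ¬ ⟦ var p ⟧) ^⊥
  ⟪ 𝟙 ⟫      = λ _ → ⊤
  ⟪ ~ φ ⟫    = ⟪ φ ⟫ ^⊥
  ⟪ φ ∧′ ψ ⟫ = ⟪ φ ⟫ ∩ ⟪ ψ ⟫

  ⟪⟫-weaken : ∀ φ {X} Y → X ∈ ⟪ φ ⟫ → X ∧ Y ∈ ⟪ φ ⟫
  ⟪⟫-weaken (var p)  Y X∈ Z Z∈        = ⊥-weaken Y (X∈ Z Z∈)
  ⟪⟫-weaken 𝟙        Y X∈             = tt
  ⟪⟫-weaken (~ φ)    Y X∈ Z Z∈        = ⊥-weaken Y (X∈ Z Z∈)
  ⟪⟫-weaken (φ ∧′ ψ) Y (X∈φ , X∈ψ)    = ⟪⟫-weaken φ Y X∈φ , ⟪⟫-weaken ψ Y X∈ψ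

  ⟪⟫-resp : ∀ φ {X Y} → X ≈ Y → X ∈ ⟪ φ ⟫ → Y ∈ ⟪ φ ⟫
  ⟪⟫-resp (var p)  X≈Y X∈ Z Z∈     = Empty-resp (∧-congʳ X≈Y) (X∈ Z Z∈)
  ⟪⟫-resp 𝟙        X≈Y X∈          = tt
  ⟪⟫-resp (~ φ)    X≈Y X∈ Z Z∈     = Empty-resp (∧-congʳ X≈Y) (X∈ Z Z∈)
  ⟪⟫-resp (φ ∧′ ψ) X≈Y (X∈φ , X∈ψ) = ⟪⟫-resp φ X≈Y X∈φ , ⟪⟫-resp ψ X≈Y X∈ψ

  -- Three orthogonals collapse to one, which settles variables and negations; the biorthogonal is
  -- monotone, which settles conjunctions. This closure is what validates `raa`.
  ⟪⟫-biorthogonal : ∀ φ {X} → X ∈ ⟪ φ ⟫ ^⊥ ^⊥ → X ∈ ⟪ φ ⟫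
  ⟪⟫-biorthogonal (var p)  X∈ Z Z∈ = X∈ Z λ Y Y∈ → ⊥-sym (Y∈ Z Z∈)
  ⟪⟫-biorthogonal 𝟙        X∈      = tt
  ⟪⟫-biorthogonal (~ φ)    X∈ Z Z∈ = X∈ Z λ Y Y∈ → ⊥-sym (Y∈ Z Z∈)
  ⟪⟫-biorthogonal (φ ∧′ ψ) X∈      =
    ⟪⟫-biorthogonal φ (λ Z Z∈ → X∈ Z λ Y Y∈ → Z∈ Y (proj₁ Y∈)) ,
    ⟪⟫-biorthogonal ψ (λ Z Z∈ → X∈ Z λ Y Y∈ → Z∈ Y (proj₂ Y∈))

  mutual
    -- Negation forces the simultaneous induction: for `~ φ`, each of the two claims follows from
    -- the other one for `φ`.
    ⟦⟧∈⟪⟫ : ∀ φ → ⟦ φ ⟧ ∈ ⟪ φ ⟫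
    ⟦⟧∈⟪⟫ (var p)  Y Y≈ = ⊥-respʳ (≈-sym Y≈) (X∧¬X-empty ⟦ var p ⟧)
    ⟦⟧∈⟪⟫ 𝟙             = tt
    ⟦⟧∈⟪⟫ (~ φ)    Y Y∈ = ⊥-sym (⊥-respʳ (≈-sym (¬-homo φ)) (⟪⟫⊆⊥¬⟦⟧ φ Y∈))
    ⟦⟧∈⟪⟫ (φ ∧′ ψ)      =
      ⟪⟫-resp φ (≈-sym (∧-homo φ ψ)) (⟪⟫-weaken φ ⟦ ψ ⟧ (⟦⟧∈⟪⟫ φ)) ,
      ⟪⟫-resp ψ (≈-trans (∧-comm ⟦ ψ ⟧ ⟦ φ ⟧) (≈-sym (∧-homo φ ψ)))
                (⟪⟫-weaken ψ ⟦ φ ⟧ (⟦⟧∈⟪⟫ ψ))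

    ⟪⟫⊆⊥¬⟦⟧ : ∀ φ {X} → X ∈ ⟪ φ ⟫ → X ⊥ ¬ ⟦ φ ⟧
    ⟪⟫⊆⊥¬⟦⟧ (var p)  X∈          = X∈ (¬ ⟦ var p ⟧) ≈-refl
    ⟪⟫⊆⊥¬⟦⟧ 𝟙        {X} X∈      =
      ⊥-respʳ (¬-cong (≈-sym 1#-homo)) (Empty-resp (∧-comm (¬ 1#) X) (∧-emptyˡ X ¬1-empty))
    ⟪⟫⊆⊥¬⟦⟧ (~ φ)    X∈          =
      ⊥-respʳ (≈-sym (≈-trans (¬-cong (¬-homo φ)) (¬-involutive ⟦ φ ⟧))) (X∈ ⟦ φ ⟧ (⟦⟧∈⟪⟫ φ))
    -- De Morgan turns the negated conjunction into a join, so this case rests on `∨-empty`.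
    ⟪⟫⊆⊥¬⟦⟧ (φ ∧′ ψ) (X∈φ , X∈ψ) =
      ⊥-respʳ (≈-sym (≈-trans (¬-cong (∧-homo φ ψ)) (deMorgan-∧ ⟦ φ ⟧ ⟦ ψ ⟧)))
              (⊥-∨ (⟪⟫⊆⊥¬⟦⟧ φ X∈φ) (⟪⟫⊆⊥¬⟦⟧ ψ X∈ψ))

  ∈⟪𝟘⟫⇒empty : ∀ {X} → X ∈ ⟪ 𝟘 ⟫ → Empty X
  ∈⟪𝟘⟫⇒empty {X} X∈ = Empty-resp (∧-identityʳ X) (X∈ 1# tt)

  -- As in forcing, an element for the context and one for the new hypothesis are merged by their
  -- meet, which stays in both interpretations.
  extend : ∀ {Γ X Y} φ → All (λ ψ → X ∈ ⟪ ψ ⟫) Γ → Y ∈ ⟪ φ ⟫ →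
           All (λ ψ → X ∧ Y ∈ ⟪ ψ ⟫) (φ ∷ Γ)
  extend {X = X} {Y} φ X∈Γ Y∈φ =
    ⟪⟫-resp φ (∧-comm Y X) (⟪⟫-weaken φ X Y∈φ) ∷ All.map (λ {ψ} → ⟪⟫-weaken ψ Y) X∈Γ

  sound : ∀ {Γ φ X} → Γ ⊢ φ → All (λ ψ → X ∈ ⟪ ψ ⟫) Γ → X ∈ ⟪ φ ⟫
  sound (hyp φ∈Γ)   X∈Γ      = lookup X∈Γ φ∈Γ
  sound 𝟙-I         X∈Γ      = tt
  sound (∧-I d e)   X∈Γ      = sound d X∈Γ , sound e X∈Γ
  sound (∧-E₁ d)    X∈Γ      = proj₁ (sound d X∈Γ)
  sound (∧-E₂ d)    X∈Γ      = proj₂ (sound d X∈Γ)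
  sound (~-I {φ} d) X∈Γ Y Y∈ = ∈⟪𝟘⟫⇒empty (sound d (extend φ X∈Γ Y∈))
  -- `X` lies in a set and in its orthogonal, so `X ⊥ X` and `X` is empty by idempotence; its meet
  -- with any `Y` is then empty, as membership in `⟪ 𝟘 ⟫` demands.
  sound {X = X} (~-E d e) X∈Γ Y _ =
    ∧-emptyˡ Y (Empty-resp (∧-idem X) (sound d X∈Γ X (sound e X∈Γ)))
  sound (raa {φ} d) X∈Γ      =
    ⟪⟫-biorthogonal φ λ Y Y∈ → ∈⟪𝟘⟫⇒empty (sound d (extend (~ φ) X∈Γ Y∈))

  theorem⇒≈1 : ∀ {φ} → ClassicalTheorem φ → ⟦ φ ⟧ ≈ 1⟨ ⟦ φ ⟧ ⟩
  theorem⇒≈1 {φ} d = ¬X-empty⇒X≈1⟨X⟩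
    (Empty-resp (∧-identityˡ (¬ ⟦ φ ⟧)) (⟪⟫⊆⊥¬⟦⟧ φ (sound {X = 1#} d [])))

-- Weakening and the Lindenbaum algebra of provable equivalence.

weaken : ∀ {p} {P : Set p} {Γ Δ : List (Formula P)} {φ} → Γ ⊆ Δ → Γ ⊢ φ → Δ ⊢ φ
weaken Γ⊆Δ (hyp φ∈Γ) = hyp (Γ⊆Δ φ∈Γ)
weaken Γ⊆Δ 𝟙-I       = 𝟙-I
weaken Γ⊆Δ (∧-I d e) = ∧-I (weaken Γ⊆Δ d) (weaken Γ⊆Δ e)
weaken Γ⊆Δ (∧-E₁ d)  = ∧-E₁ (weaken Γ⊆Δ d)
weaken Γ⊆Δ (∧-E₂ d)  = ∧-E₂ (weaken Γ⊆Δ d)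
weaken Γ⊆Δ (~-I d)   = ~-I (weaken (∷⁺ʳ _ Γ⊆Δ) d)
weaken Γ⊆Δ (~-E d e) = ~-E (weaken Γ⊆Δ d) (weaken Γ⊆Δ e)
weaken Γ⊆Δ (raa d)   = raa (weaken (∷⁺ʳ _ Γ⊆Δ) d)

module Lindenbaum {p} (P : Set p) where

  infix 4 _≤_ _≈_

  -- Quantifying over contexts makes transitivity mere composition and lets an inequality be applied
  -- under discharged hypotheses, without a cut lemma.
  _≤_ : Rel (Formula P) p
  φ ≤ ψ = ∀ Γ → Γ ⊢ φ → Γ ⊢ ψ

  _≈_ : Rel (Formula P) p
  φ ≈ ψ = φ ≤ ψ × ψ ≤ φ

  private
    variable
      Γ : List (Formula P)
      φ ψ χ : Formula P

  ↑ : Γ ⊢ φ → ψ ∷ Γ ⊢ φ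
  ↑ = weaken (xs⊆x∷xs _ _)

  #0 : φ ∷ Γ ⊢ φ
  #0 = hyp (here refl)

  #1 : φ ∷ ψ ∷ Γ ⊢ ψ
  #1 = ↑ #0

  ex-falso : Γ ⊢ 𝟘 → Γ ⊢ φ
  ex-falso d = raa (↑ d)

  ∨-I₁ : Γ ⊢ φ → Γ ⊢ φ ∨′ ψ
  ∨-I₁ d = ~-I (~-E (∧-E₁ #0) (↑ d))

  ∨-I₂ : Γ ⊢ ψ → Γ ⊢ φ ∨′ ψ
  ∨-I₂ d = ~-I (~-E (∧-E₂ #0) (↑ d))

  excluded-middle : Γ ⊢ φ ∨′ ~ φ
  excluded-middle = ~-I (~-E (∧-E₂ #0) (∧-E₁ #0))

  ~-mono : φ ≤ ψ → ~ ψ ≤ ~ φ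
  ~-mono φ≤ψ Γ d = ~-I (~-E (↑ d) (φ≤ψ _ #0))

  ∨-least : φ ≤ χ → ψ ≤ χ → φ ∨′ ψ ≤ χ
  ∨-least φ≤χ ψ≤χ Γ d =
    raa (~-E (↑ d) (∧-I (~-mono φ≤χ _ #0) (~-mono ψ≤χ _ #0)))

  infixr 5 _⇨_
  _⇨_ : Formula P → Formula P → Formula P
  φ ⇨ ψ = ~ (φ ∧′ ~ ψ)

  curry : φ ∧′ ψ ≤ χ → φ ≤ ψ ⇨ χ
  curry φ∧ψ≤χ Γ d = ~-I (~-E (∧-E₂ #0) (φ∧ψ≤χ _ (∧-I (↑ d) (∧-E₁ #0))))

  uncurry : φ ≤ ψ ⇨ χ → φ ∧′ ψ ≤ χ
  uncurry φ≤ψ⇨χ Γ d = raa (~-E (φ≤ψ⇨χ _ (↑ (∧-E₁ d))) (∧-I (↑ (∧-E₂ d)) #0))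

  -- The adjunction for `_⇨_` is proved so that distributivity follows from the general theory of
  -- Heyting algebras instead of by explicit derivations.
  heytingAlgebra : HeytingAlgebra p p p
  heytingAlgebra = record
    { Carrier = Formula P
    ; _≈_     = _≈_
    ; _≤_     = _≤_
    ; _∨_     = _∨′_
    ; _∧_     = _∧′_
    ; _⇨_     = _⇨_
    ; ⊤       = 𝟙
    ; ⊥       = 𝟘
    ; isHeytingAlgebra = record
      { isBoundedLattice = record
        { isLattice = record
          { isPartialOrder = record
            { isPreorder = record
              { isEquivalence = record
                { refl  = (λ _ → id) , (λ _ → id)
                ; sym   = swap
                ; trans = λ (f , f′) (g , g′) → (λ Γ → g Γ ∘ f Γ) , (λ Γ → f′ Γ ∘ g′ Γ)
                }
              ; reflexive = proj₁
              ; trans     = λ f g Γ → g Γ ∘ f Γ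
              }
            ; antisym = _,_
            }
          ; supremum = λ φ ψ → (λ _ → ∨-I₁) , (λ _ → ∨-I₂) , λ χ → ∨-least
          ; infimum  = λ φ ψ → (λ _ → ∧-E₁) , (λ _ → ∧-E₂) ,
                               λ χ f g Γ d → ∧-I (f Γ d) (g Γ d)
          }
        ; maximum = λ _ _ _ → 𝟙-I
        ; minimum = λ _ _ → ex-falso
        }
      ; exponential = λ φ ψ χ → curry , uncurry
      }
    }

  booleanAlgebra : BooleanAlgebra p p
  booleanAlgebra = record
    { isBooleanAlgebra = isBooleanAlgebraʳ record
      { isDistributiveLattice = record
        { isLattice   = OL.isAlgLattice
        ; ∨-distrib-∧ = D.∨-distrib-∧
        ; ∧-distrib-∨ = D.∧-distrib-∨
        }
      ; ∨-complementʳ = λ φ → (λ _ _ → 𝟙-I) , (λ _ _ → excluded-middle)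
      ; ∧-complementʳ = λ φ → (λ _ d → ~-E (∧-E₂ d) (∧-E₁ d)) , (λ _ → ex-falso)
      ; ¬-cong        = λ (f , g) → ~-mono g , ~-mono f
      }
    }
    where
    module H = HeytingProperties heytingAlgebra
    module D = DistributiveProperties H.distributiveLattice
    module OL = OrderLatticeProperties (HeytingAlgebra.lattice heytingAlgebra)

-- Boolean algebras as relativized Boolean algebras, at raised universe levels.

relativized : ∀ {a b} c ℓ → BooleanAlgebra a b → RelativizedBooleanAlgebra (a ⊔ c) (b ⊔ ℓ)
relativized {b = b} c ℓ B = record
  { algebra = record
    { Carrier       = Lift c Carrier
    ; _≈_           = λ X Y → Lift ℓ (lower X ≈ lower Y)
    ; _∧_           = λ X Y → lift (lower X ∧ lower Y)
    ; _∨_           = λ X Y → lift (lower X ∨ lower Y)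
    ; ¬_            = λ X → lift (¬ lower X)
    ; 0#            = lift ⊥ᴮ
    ; 1#            = lift ⊤ᴮ
    ; ≈-equivalence = record
      { refl  = lift ≈-refl
      ; sym   = λ e → lift (sym (lower e))
      ; trans = λ e f → lift (trans (lower e) (lower f))
      }
    ; ∧-cong        = λ e f → lift (∧-cong (lower e) (lower f))
    ; ∨-cong        = λ e f → lift (∨-cong (lower e) (lower f))
    ; ¬-cong        = λ e → lift (¬-cong (lower e))
    }
  ; isRelativizedBooleanAlgebra = record
    { ∧-assoc     = λ _ _ _ → lift (∧-assoc _ _ _)
    ; ∨-assoc     = λ _ _ _ → lift (∨-assoc _ _ _)
    ; ∧-comm      = λ _ _ → lift (∧-comm _ _)
    ; ∨-comm      = λ _ _ → lift (∨-comm _ _)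
    ; ∧-distrib-∨ = (λ _ _ _ → lift (∧-distribˡ-∨ _ _ _)) , λ _ _ _ → lift (∧-distribʳ-∨ _ _ _)
    ; ∨-distrib-∧ = (λ _ _ _ → lift (∨-distribˡ-∧ _ _ _)) , λ _ _ _ → lift (∨-distribʳ-∧ _ _ _)
    ; deMorgan-∧  = λ _ _ → lift (deMorgan₁ _ _)
    ; deMorgan-∨  = λ _ _ → lift (deMorgan₂ _ _)
    ; ∧-idem      = λ _ → lift (∧-idem _)
    ; ∨-idem      = λ _ → lift (∨-idem _)
    ; ∧-identityʳ = λ _ → lift (∧-identityʳ _)
    ; ¬-involutive = λ _ → lift (¬-involutive _)
    ; ∨-1#        = λ _ → lift (trans (∨-zeroʳ _) (sym (∨-complementʳ _)))
    ; ∧-zeroʳ     = λ _ → lift (∧-zeroʳ _)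
    -- Here `1⟨ Y ⟩` is the top, so meeting with it changes neither side.
    ; ¬-restrict  = λ X Y _ → lift
        (trans (¬-cong (∧1 (lower X) (lower Y))) (sym (∧1 (¬ lower X) (lower Y))))
    }
  }
  where
  open BooleanAlgebra B renaming (⊤ to ⊤ᴮ; ⊥ to ⊥ᴮ; refl to ≈-refl)
  open BooleanProperties B using
    (deMorgan₁; deMorgan₂; ¬-involutive; ∧-identityʳ; ∧-zeroʳ; ∨-zeroʳ)
  open LatticeProperties lattice using (∧-idem; ∨-idem)

  ∧1 : ∀ x y → x ∧ (y ∨ ¬ y) ≈ x
  ∧1 x y = trans (∧-congˡ (∨-complementʳ y)) (∧-identityʳ x)

-- Completeness by evaluation in the Lindenbaum algebra.

module Completeness {p} (c ℓ : Level) (P : Set p) where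

  open Lindenbaum P
  open BooleanAlgebra booleanAlgebra using () renaming (refl to ≈-refl; reflexive to ≈-reflexive)

  lindenbaum : RelativizedBooleanAlgebra (p ⊔ c) (p ⊔ ℓ)
  lindenbaum = relativized c ℓ booleanAlgebra

  -- Setoid equality already performs the quotient, so on elements the map is the identity up to
  -- level lifting.
  quotient : Homomorphism (formulaAlgebra P) (RelativizedBooleanAlgebra.algebra lindenbaum)
  quotient = record
    { ⟦_⟧     = lift
    ; ⟦⟧-cong = λ e → lift (≈-reflexive e)
    ; 1#-homo = lift ≈-refl
    ; ∧-homo  = λ _ _ → lift ≈-refl
    ; ∨-homo  = λ _ _ → lift ≈-refl
    ; ¬-homo  = λ _ → lift ≈-refl
    }

  valid⇒theorem : ∀ {φ} → Valid (p ⊔ c) (p ⊔ ℓ) φ → ClassicalTheorem φ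
  valid⇒theorem v with v lindenbaum quotient
  -- Whatever the witness is, its `1⟨_⟩` is an instance of excluded middle; the inequality at the
  -- empty context carries its derivation to `φ`.
  ... | _ , lift (_ , 1≤φ) = 1≤φ [] excluded-middle

proposition3 : ∀ {p} (c ℓ : Level) (P : Set p) (φ : Formula P) →
    ClassicalTheorem φ ⇔ Valid (p ⊔ c) (p ⊔ ℓ) φ
proposition3 c ℓ P φ = mk⇔
  (λ d RB h → Homomorphism.⟦_⟧ h φ , Soundness.theorem⇒≈1 RB h d)
  (Completeness.valid⇒theorem c ℓ P)
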